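{- Let $R$ be a set of $n$ real numbers and $k$ a positive integer. Apart from the time required to sort $R$, Algorithm 2 (defined in the context) on input $(R,k)$ runs in $O(n+k\log_2 k)$ time. If it is required to report the subsets (that is, to list the elements of each of the $k$ output subsets), it takes $O(nk+k\log_2 k)$ time.
   Context: The numbers of $R$ are sorted as $R[1]\le\dots\le R[n]$. A nonempty subset $S\subseteq R$ is identified with its bit-pattern $B[1\ldots n]$, where $B[i]=1$ iff $R[i]\in S$; its value is $F(S)=\sum_{r\in S}r$. The goal is to generate the $k$ nonempty subsets with smallest values, in order of value, ties broken arbitrarily. Node record for $S$: the bit-pattern $B[1\ldots n]$, the size $ls=|S|$, the value $F(S)$, and three pointers $(p_1,p_2,p_3)$: $p_1$ is the position of the first 1 appearing after the first block of 0s in $B$ ($p_1=0$ if there is none); $p_2$ is the position of the rightmost 1 of the first contiguous block of 1s if $B[1]=1$, and $p_2=0$ otherwise; $p_3$ is the position of the rightmost 1 in $B$. Children of a node (at most two in total), each created from the parent's record with the value and pointers updated accordingly: (a) if $1<p_1<n$ and $B[p_1+1]=0$, the child obtained by swapping $B[p_1]$ and $B[p_1+1]$; (b) if $0<p_2<n$, the child obtained by swapping $B[p_2]$ and $B[p_2+1]$; (c) if $(p_1,p_2,p_3)=(2,0,ls+1)$, the child obtained by setting $B[1]=1$. Algorithm 2: after sorting $R$, create the root record, for the subset $\{R[1]\}$ (bit-pattern $10\cdots0$, pointers $(0,1,1)$, size $1$, value $R[1]$), and insert it in a min-max-heap $H$ keyed by value. For $q=1,\dots,k$: extract the node of minimum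 value from $H$, output its bit-pattern and value as the $q$-th best subset, create its children by rules (a), (b), (c) and insert them in $H$; then, if the number of elements in $H$ exceeds $k-q$, remove the element of maximum value from $H$. Cost convention: arithmetic operations and comparisons of real numbers take unit time, and creating a child from its parent's record is charged incrementally, i.e. only the $O(1)$ changes of bits, pointers and value that distinguish the child's record from the parent's are counted. -}

module Defs where

open import Level using (Level) renaming (suc to lsuc; _⊔_ to _⊔ˡ_)
open import Algebra.Structures using (IsCommutativeRing)
open import Data.Bool.Base using (Bool; true; false; not; _∧_; if_then_else_)
open import Data.List.Base using (List; []; _∷_)
open import Data.List.Relation.Binary.Permutation.Propositional.Properties
  using (↭-length)
import Data.List.Sort as Sort
open import Data.Maybe.Base using (Maybe; just; nothing)
open import Data.Nat.Base
  using (ℕ; zero; suc; pred; NonZero; ⌊_/2⌋; _≤ᵇ_; _<ᵇ_; _≡ᵇ_)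
  renaming (_+_ to _+ℕ_; _*_ to _*ℕ_)
open import Data.Product.Base using (_×_; _,_; ∃-syntax)
open import Data.Vec.Base using (Vec; []; _∷_; toList; fromList; cast)
open import Data.Vec.Properties using (length-toList)
import Data.Vec.Relation.Unary.Unique.Setoid as UniqueSetoid
open import Function.Base using (flip)
open import Relation.Binary.Bundles using (DecTotalOrder)
open import Relation.Binary.PropositionalEquality using (trans)
open import Relation.Binary.Structures using (IsDecTotalOrder)
open import Relation.Nullary.Decidable using (does)
open import Relation.Nullary.Negation using (¬_)

private
  variable
    a b : Level
    A : Set a
    B : Set b
    n : ℕ

-- The library has no type of real numbers.  The algorithm only uses the real
-- numbers through exact arithmetic and decided comparisons, so they are
-- replaced by an arbitrary linearly ordered field with a decidable order.

record OrderedField c ℓ₁ ℓ₂ : Set (lsuc (c ⊔ˡ ℓ₁ ⊔ˡ ℓ₂)) where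
  infix  8 -_
  infixl 7 _*_
  infixl 6 _+_ _-_
  infix  4 _≈_ _≤_
  field
    Carrier           : Set c
    _≈_               : Carrier → Carrier → Set ℓ₁
    _≤_               : Carrier → Carrier → Set ℓ₂
    _+_ _*_           : Carrier → Carrier → Carrier
    -_                : Carrier → Carrier
    0# 1#             : Carrier
    isCommutativeRing : IsCommutativeRing _≈_ _+_ _*_ -_ 0# 1#
    isDecTotalOrder   : IsDecTotalOrder _≈_ _≤_
    0≉1               : ¬ (0# ≈ 1#)
    invertible        : ∀ x → ¬ (x ≈ 0#) → ∃[ y ] x * y ≈ 1#
    +-monoˡ-≤         : ∀ z {x y} → x ≤ y → (x + z) ≤ (y + z)
    *-nonNegative     : ∀ {x y} → 0# ≤ x → 0# ≤ y → 0# ≤ (x * y)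

  _-_ : Carrier → Carrier → Carrier
  x - y = x + (- y)

  decTotalOrder : DecTotalOrder c ℓ₁ ℓ₂
  decTotalOrder = record { isDecTotalOrder = isDecTotalOrder }

  open DecTotalOrder decTotalOrder public using (_≤?_; module Eq)

------------------------------------------------------------------------
-- Unit-cost computations

-- A result together with the number of elementary operations spent on it.
-- The only charging primitive is `step`; it is applied to one elementary
-- operation at a time: a test or arithmetic operation on pointers or real
-- numbers, or one access to an array cell.

record Timed (A : Set a) : Set a where
  constructor _after_
  field
    result : A
    time   : ℕ

open Timed public

infixl 1 _>>=_

return : A → Timed A
return x = x after 0

step : A → Timed A
step x = x after 1

_>>=_ : Timed A → (A → Timed B) → Timed B
m >>= f = result (f (result m)) after (time m +ℕ time (f (result m)))

-- Memory for the heap: an unbounded array of cells with unspecified initial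
-- content, so that allocating it is free.

Array : Set a → Set a
Array A = ℕ → A

read : Array A → ℕ → Timed A
read M i = step (M i)

write : Array A → ℕ → A → Timed (Array A)
write M i x = step (λ j → if j ≡ᵇ i then x else M j)

swap : Array A → ℕ → ℕ → Timed (Array A)
swap M i j = do
  x ← read M i
  y ← read M j
  M ← write M i y
  write M j x

-- Cells of a vector, with positions counted from 1.  Positions outside 1,…,n
-- never occur in the algorithm; reading there yields the default d.

cell : A → Vec A n → ℕ → A
cell d []       _             = d
cell d (x ∷ xs) zero          = d
cell d (x ∷ xs) (suc zero)    = x
cell d (x ∷ xs) (suc (suc i)) = cell d xs (suc i)

setCell : Vec A n → ℕ → A → Vec A n
setCell []       _             y = []
setCell (x ∷ xs) zero          y = x ∷ xs
setCell (x ∷ xs) (suc zero)    y = y ∷ xs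
setCell (x ∷ xs) (suc (suc i)) y = x ∷ setCell xs (suc i) y

------------------------------------------------------------------------
-- Min-max heaps

-- The array implementation of Atkinson, Sack, Santoro and Strothotte: the
-- elements are in cells 1,…,size, the children of cell i are 2i and 2i+1,
-- cells at even depth (the root has depth 0) are minimal and cells at odd
-- depth are maximal among their descendants.  Keys are compared by the strict
-- test _≺_; the code for max levels is that for min levels with ≺ reversed.
--
-- The argument called `fuel` is only there to make termination evident.
-- Every recursive call at least doubles (trickleDown) or at least halves
-- (onMinLevel, bubbleUp) the position, so the fuel supplied by the callers is
-- never exhausted before the procedure stops of its own accord.

module MinMaxHeap {a} {A : Set a} (_≺_ : A → A → Bool) where

  record Heap : Set a where
    constructor heap
    field
      size  : ℕ
      cells : Array A

  open Heap public

  -- The given element only serves as initial memory content.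
  empty : A → Heap
  empty junk = heap 0 (λ _ → junk)

  private
    Order : Set a
    Order = A → A → Bool

  -- A ⊏-least cell among m and those of the listed cells that are ≤ s.
  least : Order → Array A → (s m : ℕ) → List ℕ → Timed ℕ
  least _⊏_ M s m []       = return m
  least _⊏_ M s m (j ∷ js) = do
    present ← step (j ≤ᵇ s)
    if present
      then (do
        x ← read M j
        y ← read M m
        smaller ← step (x ⊏ y)
        least _⊏_ M s (if smaller then j else m) js)
      else least _⊏_ M s m js

  trickleDown : Order → (fuel : ℕ) → Array A → (s i : ℕ) → Timed (Array A)
  trickleDown _⊏_ zero       M s i = return M
  trickleDown _⊏_ (suc fuel) M s i = do
    c₀ ← step (2 *ℕ i)
    leaf ← step (s <ᵇ c₀)
    if leaf then return M else do
      c₁ ← step (1 +ℕ c₀)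
      g₀ ← step (2 *ℕ c₀)
      g₁ ← step (1 +ℕ g₀)
      g₂ ← step (1 +ℕ g₁)
      g₃ ← step (1 +ℕ g₂)
      m ← least _⊏_ M s c₀ (c₁ ∷ g₀ ∷ g₁ ∷ g₂ ∷ g₃ ∷ [])
      x ← read M i
      y ← read M m
      smaller ← step (y ⊏ x)
      if not smaller then return M else do
        M ← swap M i m
        grandchild ← step (g₀ ≤ᵇ m)
        if not grandchild then return M else do
          p ← step ⌊ m /2⌋
          z ← read M p
          misplaced ← step (z ⊏ x)
          M ← (if misplaced then swap M m p else return M)
          trickleDown _⊏_ fuel M s m

  onMinLevel : (fuel i : ℕ) → Timed Bool
  onMinLevel zero       i = return true
  onMinLevel (suc fuel) i = do
    root ← step (i ≤ᵇ 1)
    if root then return true else do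
      p ← step ⌊ i /2⌋
      parentOnMin ← onMinLevel fuel p
      step (not parentOnMin)

  -- Moves the element of cell i up along grandparents.
  bubbleUp : Order → (fuel : ℕ) → Array A → (i : ℕ) → Timed (Array A)
  bubbleUp _⊏_ zero       M i = return M
  bubbleUp _⊏_ (suc fuel) M i = do
    noGrandparent ← step (i <ᵇ 4)
    if noGrandparent then return M else do
      p ← step ⌊ i /2⌋
      g ← step ⌊ p /2⌋
      x ← read M i
      y ← read M g
      smaller ← step (x ⊏ y)
      if not smaller then return M else do
        M ← swap M i g
        bubbleUp _⊏_ fuel M g

  -- Restores the heap order after the element of cell i has been added;
  -- _⊏_ is the order that belongs to the level of i.
  placeUp : Order → Array A → (i : ℕ) → Timed (Array A)
  placeUp _⊏_ M i = do
    root ← step (i ≤ᵇ 1)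
    if root then return M else do
      p ← step ⌊ i /2⌋
      x ← read M i
      y ← read M p
      wrongSide ← step (y ⊏ x)
      if wrongSide
        then (do
          M ← swap M i p
          bubbleUp (flip _⊏_) p M p)
        else bubbleUp _⊏_ i M i

  insert : A → Heap → Timed Heap
  insert x (heap s M) = do
    s ← step (suc s)
    M ← write M s x
    min ← onMinLevel s s
    M ← (if min then placeUp _≺_ M s else placeUp (flip _≺_) M s)
    return (heap s M)

  -- Overwrites cell i by the last element, which is dropped from the end.
  removeAt : Order → ℕ → Heap → Timed Heap
  removeAt _⊏_ i (heap s M) = do
    x ← read M s
    M ← write M i x
    s ← step (pred s)
    M ← trickleDown _⊏_ s M s i
    return (heap s M)

  extractMin : Heap → Timed (Maybe (A × Heap))
  extractMin H = do
    isEmpty ← step (size H ≡ᵇ 0)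
    if isEmpty then return nothing else do
      x ← read (cells H) 1
      H ← removeAt _≺_ 1 H
      return (just (x , H))

  deleteMax : Heap → Timed Heap
  deleteMax H = do
    isEmpty ← step (size H ≡ᵇ 0)
    if isEmpty then return H else do
      single ← step (size H ≡ᵇ 1)
      if single then removeAt (flip _≺_) 1 H else do
        two ← step (size H ≡ᵇ 2)
        if two then removeAt (flip _≺_) 2 H else do
          x ← read (cells H) 2
          y ← read (cells H) 3
          smaller ← step (x ≺ y)
          removeAt (flip _≺_) (if smaller then 3 else 2) H

------------------------------------------------------------------------
-- The algorithm

module BestSubsets {c ℓ₁ ℓ₂} (ℝ : OrderedField c ℓ₁ ℓ₂) where

  open OrderedField ℝ

  open UniqueSetoid (DecTotalOrder.Eq.setoid decTotalOrder) public using (Unique)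
  open Sort decTotalOrder using () renaming (sort to sortList; sort-↭ to sortList-↭)

  sort : Vec Carrier n → Vec Carrier n
  sort R = cast (trans (↭-length (sortList-↭ (toList R))) (length-toList R))
                (fromList (sortList (toList R)))

  -- In the fields p₁, p₂, p₃ positions are counted from 1 and 0 means none.
  record Node (n : ℕ) : Set c where
    constructor node
    field
      bits     : Vec Bool n
      ls       : ℕ
      value    : Carrier
      p₁ p₂ p₃ : ℕ

  open Node public

  _≺_ : Node n → Node n → Bool
  N ≺ N′ = not (does (value N′ ≤? value N))

  module H {n} = MinMaxHeap (_≺_ {n})

  readBit : Vec Bool n → ℕ → Timed Bool
  readBit B i = step (cell false B i)

  writeBit : Vec Bool n → ℕ → Bool → Timed (Vec Bool n)
  writeBit B i x = step (setCell B i x)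

  readNumber : Vec Carrier n → ℕ → Timed Carrier
  readNumber R i = step (cell 0# R i)

  -- The effect of swapping B[i] = 1 and B[i+1] = 0 on the bit-pattern, the
  -- value and p₃.  Only the changed parts of the record are charged; the
  -- unchanged part of the bit-pattern is not copied.
  moveRight : Vec Carrier n → ℕ → Node n → Timed (Vec Bool n × Carrier × ℕ)
  moveRight R i N = do
    i′ ← step (suc i)
    x ← readBit (bits N) i
    y ← readBit (bits N) i′
    B ← writeBit (bits N) i y
    B ← writeBit B i′ x
    r ← readNumber R i
    r′ ← readNumber R i′
    F ← step (value N - r)
    F ← step (F + r′)
    rightmost ← step (p₃ N ≡ᵇ i)
    q₃ ← step (if rightmost then i′ else p₃ N)
    return (B , F , q₃)

  childA : Vec Carrier n → Node n → Timed (Maybe (Node n))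
  childA {n} R N = do
    lower ← step (1 <ᵇ p₁ N)
    upper ← step (p₁ N <ᵇ n)
    if not (lower ∧ upper) then return nothing else do
      i′ ← step (suc (p₁ N))
      occupied ← readBit (bits N) i′
      if occupied then return nothing else do
        (B , F , q₃) ← moveRight R (p₁ N) N
        q₁ ← step i′
        return (just (node B (ls N) F q₁ (p₂ N) q₃))

  -- After the swap the first block of 1s, if B[1] is still 1, ends at p₂ - 1,
  -- and the first 1 after the first block of 0s is at p₂ + 1.
  childB : Vec Carrier n → Node n → Timed (Maybe (Node n))
  childB {n} R N = do
    lower ← step (0 <ᵇ p₂ N)
    upper ← step (p₂ N <ᵇ n)
    if not (lower ∧ upper) then return nothing else do
      (B , F , q₃) ← moveRight R (p₂ N) N
      q₁ ← step (suc (p₂ N))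
      q₂ ← step (pred (p₂ N))
      return (just (node B (ls N) F q₁ q₂ q₃))

  -- Here B = 0 1 ⋯ 1 0 ⋯ 0 with the 1s at 2,…,ls+1, so that the child has a
  -- single block of 1s, which ends at p₃.
  childC : Vec Carrier n → Node n → Timed (Maybe (Node n))
  childC R N = do
    second ← step (p₁ N ≡ᵇ 2)
    noFirst ← step (p₂ N ≡ᵇ 0)
    l ← step (suc (ls N))
    oneBlock ← step (p₃ N ≡ᵇ l)
    if not (second ∧ noFirst ∧ oneBlock) then return nothing else do
      B ← writeBit (bits N) 1 true
      r ← readNumber R 1
      F ← step (value N + r)
      q₁ ← step 0
      q₂ ← step (p₃ N)
      return (just (node B l F q₁ q₂ (p₃ N)))

  zeros : (n : ℕ) → Timed (Vec Bool n)
  zeros zero    = return []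
  zeros (suc n) = do
    B ← zeros n
    step (false ∷ B)

  -- The record of {R[1]}.
  root : Vec Carrier n → Timed (Node n)
  root {n} R = do
    B ← zeros n
    B ← writeBit B 1 true
    r ← readNumber R 1
    l ← step 1
    q₁ ← step 0
    q₂ ← step 1
    q₃ ← step 1
    return (node B l r q₁ q₂ q₃)

  insertMaybe : Maybe (Node n) → H.Heap {n} → Timed (H.Heap {n})
  insertMaybe nothing  Q = return Q
  insertMaybe (just N) Q = H.insert N Q

  module _ {o} {O : Set o} (output : Node n → Timed O) (R : Vec Carrier n) where

    -- The iterations q,…,k, where the first argument is k - q + 1.  If the
    -- heap is empty (k exceeds the number of subsets), the algorithm stops.
    iterate : ℕ → H.Heap {n} → Timed (List O)
    iterate zero      Q = return []
    iterate (suc k-q) Q = do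
      just (N , Q) ← H.extractMin Q
        where nothing → return []
      out ← output N
      A ← childA R N
      B ← childB R N
      C ← childC R N
      Q ← insertMaybe A Q
      Q ← insertMaybe B Q
      Q ← insertMaybe C Q
      tooMany ← step (k-q <ᵇ H.size Q)
      Q ← (if tooMany then H.deleteMax Q else return Q)
      outs ← iterate k-q Q
      return (out ∷ outs)

    afterSorting : ℕ → Timed (List O)
    afterSorting k = do
      N ← root R
      Q ← H.insert N (H.empty N)
      iterate k Q

  -- Outputs a subset as its bit-pattern and value; the bit-pattern is that of
  -- the record, handed over without copying.
  emit : Node n → Timed (Vec Bool n × Carrier)
  emit N = step (bits N , value N)

  elements : Vec Bool n → Vec Carrier n → Timed (List Carrier)
  elements []      []      = return []
  elements (b ∷ B) (r ∷ R) = do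
    rs ← elements B R
    chosen ← step b
    if chosen then step (r ∷ rs) else return rs

  -- Outputs a subset as the list of its elements and its value.
  report : Vec Carrier n → Node n → Timed (List Carrier × Carrier)
  report R N = do
    rs ← elements (bits N) R
    step (rs , value N)

  -- Both versions leave the sorting of R uncharged.

  algorithm2 : Vec Carrier n → ℕ → Timed (List (Vec Bool n × Carrier))
  algorithm2 R k = do
    S ← return (sort R)
    afterSorting emit S k

  algorithm2Reporting : Vec Carrier n → ℕ → Timed (List (List Carrier × Carrier))
  algorithm2Reporting R k = do
    S ← return (sort R)
    afterSorting (report S) S k

-- A heap operation moves along positions that at least double or at least halve
-- at each level, with at most 42 charged operations per level, so on a heap with
-- fewer than 2 ^ d elements it takes time linear in 1 + d.  Before any iteration
-- the heap has at most 1 + 2 k < 2 ^ (2 + ⌊log₂ k⌋) elements, whether or not the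
-- deletions of the maximum take place, so an iteration takes O(1 + log k) on top
-- of its output.  For k = 1, where log k = 0, the constant per iteration is
-- absorbed by n.

module Submission where

open import Defs
open import Level using (Level)
open import Data.Bool.Base using (Bool; true; false; not; _∧_; if_then_else_; T)
open import Data.List.Base using (List; []; _∷_; length)
open import Data.Maybe.Base using (Maybe; just; nothing)
open import Data.Nat.Base
open import Data.Nat.Logarithm using (⌊log₂_⌋; ⌊log₂⌋-mono-≤; ⌊log₂[2^n]⌋≡n)
open import Data.Nat.Properties
open import Data.Nat.Solver using (module +-*-Solver)
open import Data.Product.Base using (_×_; _,_; ∃-syntax)
open import Data.Unit.Base using (tt)
open import Data.Vec.Base using (Vec; []; _∷_)
open import Function.Base using (flip)
open import Relation.Binary.PropositionalEquality using (_≡_; refl; cong; subst)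
open import Relation.Nullary.Negation using (¬_; contradiction)

open +-*-Solver using (solve; con; _:+_; _:*_; _:=_)

-- Costs of branches and elementary inequalities.

private
  variable
    ℓ : Level
    A : Set ℓ

-- The second branch receives the outcome of the test. This is how the leaf test enters the bound
-- for `trickleDown` and, through `time-if-not`, the grandchild test.
time-if : ∀ b {x y : Timed A} {t} →
          time x ≤ t → (¬ T b → time y ≤ t) → time (if b then x else y) ≤ t
time-if true  x≤t y≤t = x≤t
time-if false x≤t y≤t = y≤t (λ ())

time-if-not : ∀ b {x y : Timed A} {t} →
              time x ≤ t → (T b → time y ≤ t) → time (if not b then x else y) ≤ t
time-if-not true  x≤t y≤t = y≤t tt
time-if-not false x≤t y≤t = x≤t

-- As `2 ^ suc d` unfolds to `2 * 2 ^ d`, moving to the parent lowers by one the exponent that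
-- bounds a position.
⌊m/2⌋<n : ∀ {m n} → m < 2 * n → ⌊ m /2⌋ < n
⌊m/2⌋<n {m} {n} m<2n = *-cancelˡ-< 2 ⌊ m /2⌋ n (≤-<-trans 2⌊m/2⌋≤m m<2n)
  where
  open ≤-Reasoning
  2⌊m/2⌋≤m : 2 * ⌊ m /2⌋ ≤ m
  2⌊m/2⌋≤m = begin
    2 * ⌊ m /2⌋            ≡⟨ cong (⌊ m /2⌋ +_) (+-identityʳ ⌊ m /2⌋) ⟩
    ⌊ m /2⌋ + ⌊ m /2⌋      ≤⟨ +-monoʳ-≤ ⌊ m /2⌋ (⌊n/2⌋≤⌈n/2⌉ m) ⟩
    ⌊ m /2⌋ + ⌈ m /2⌉      ≡⟨ ⌊n/2⌋+⌈n/2⌉≡n m ⟩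
    m                      ∎

n<2^[1+⌊log₂n⌋] : ∀ n → n < 2 ^ suc ⌊log₂ n ⌋
n<2^[1+⌊log₂n⌋] n = ≰⇒> (λ 2^≤n →
  1+n≰n (subst (_≤ ⌊log₂ n ⌋) (⌊log₂[2^n]⌋≡n (suc ⌊log₂ n ⌋)) (⌊log₂⌋-mono-≤ 2^≤n)))

-- Absorbs constant overheads; the heap bounds are multiples of `suc d` rather than `d` so that this
-- works at `d = 0` too.
+-*-suc-≤ : ∀ c b d → c + b * suc d ≤ (c + b) * suc d
+-*-suc-≤ c b d = begin
  c + b * suc d         ≤⟨ +-monoˡ-≤ (b * suc d) (m≤m*n c (suc d)) ⟩
  c * suc d + b * suc d ≡⟨ *-distribʳ-+ (suc d) c b ⟨
  (c + b) * suc d       ∎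
  where open ≤-Reasoning

-- Running time of the min-max heap operations.

module HeapTime {a} {A : Set a} (_≺_ : A → A → Bool) where

  open MinMaxHeap _≺_

  least-time : ∀ _⊏_ M s m js → time (least _⊏_ M s m js) ≤ 4 * length js
  least-time _⊏_ M s m []       = z≤n
  least-time _⊏_ M s m (j ∷ js) = begin
    suc (time (if j ≤ᵇ s then _ else _))
      ≤⟨ s≤s (time-if (j ≤ᵇ s)
           (+-monoʳ-≤ 3 (least-time _⊏_ M s _ js))
           (λ _ → m≤n⇒m≤o+n 3 (least-time _⊏_ M s m js))) ⟩
    4 + 4 * length js
      ≡⟨ *-suc 4 (length js) ⟨
    4 * length (j ∷ js) ∎
    where open ≤-Reasoning

  private
    -- The rest of a call of trickleDown once least has returned m.  Keeping m
    -- a variable avoids an exponential unfolding of least during conversion.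
    descend : (A → A → Bool) → (fuel : ℕ) → Array A → (s i m : ℕ) → Timed (Array A)
    descend _⊏_ fuel M s i m = do
      x ← read M i
      y ← read M m
      smaller ← step (y ⊏ x)
      if not smaller then return M else do
        M ← swap M i m
        grandchild ← step (2 * (2 * i) ≤ᵇ m)
        if not grandchild then return M else do
          p ← step ⌊ m /2⌋
          z ← read M p
          misplaced ← step (z ⊏ x)
          M ← (if misplaced then swap M m p else return M)
          trickleDown _⊏_ fuel M s m

    -- The recursive call lies behind the test `2 * (2 * i) ≤ᵇ m`, so its bound `t` is demanded only
    -- when that test succeeds. The 15 operations include two swaps of 4 each.
    descend-time : ∀ _⊏_ fuel M s i m {t} →
      (2 * (2 * i) ≤ m → ∀ M′ → time (trickleDown _⊏_ fuel M′ s m) ≤ t) →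
      time (descend _⊏_ fuel M s i m) ≤ 15 + t
    descend-time _⊏_ fuel M s i m recursive≤t =
      +-monoʳ-≤ 3 (time-if-not (M m ⊏ M i) z≤n (λ _ →
      +-monoʳ-≤ 5 (time-if-not (2 * (2 * i) ≤ᵇ m) z≤n (λ grandchild →
      +-monoʳ-≤ 3 (+-mono-≤
        (time-if (result (swap M i m) ⌊ m /2⌋ ⊏ M i) {t = 4} ≤-refl (λ _ → z≤n))
        (recursive≤t (≤ᵇ⇒≤ (2 * (2 * i)) m grandchild) _))))))

  -- The bound is governed by `d`, not by `fuel`: `d` doublings carry position `i` past `s`. A
  -- recursive call goes to a position at least `4 * i`, and a doubling already lowers `d` by one.
  trickleDown-time : ∀ _⊏_ fuel M s i d → s < 2 ^ d * i →
                     time (trickleDown _⊏_ fuel M s i) ≤ 42 * suc d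
  trickleDown-time _⊏_ zero       M s i d s<2^d*i = z≤n
  -- From `s < i` follows `s < 2 * i`, so the leaf test succeeds.
  trickleDown-time _⊏_ (suc fuel) M s i zero s<i =
    +-monoʳ-≤ 2 (time-if (s <ᵇ 2 * i) z≤n (λ nonLeaf →
      contradiction (<⇒<ᵇ (<-≤-trans s<i (+-monoʳ-≤ i z≤n))) nonLeaf))
  trickleDown-time _⊏_ (suc fuel) M s i (suc d) s<2^d*i =
    let c = 2 * i
        g = 2 * c
    in begin
    time (trickleDown _⊏_ (suc fuel) M s i)
      -- 42 = 2 + 5 + 4 * 5 + 15, where `least` inspects five cells and `descend` takes 15.
      ≤⟨ +-monoʳ-≤ 2 (time-if (s <ᵇ 2 * i) z≤n (λ _ →
         +-monoʳ-≤ 5 (+-mono-≤ (least-time _⊏_ M s c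
             (1 + c ∷ g ∷ 1 + g ∷ 1 + (1 + g) ∷ 1 + (1 + (1 + g)) ∷ []))
           (descend-time _⊏_ fuel M s i _ (λ 4i≤m M′ →
             trickleDown-time _⊏_ fuel M′ s _ d (deeper 4i≤m)))))) ⟩
    42 + 42 * suc d
      ≡⟨ *-suc 42 (suc d) ⟨
    42 * suc (suc d) ∎
    where
    open ≤-Reasoning
    deeper : ∀ {m} → 2 * (2 * i) ≤ m → s < 2 ^ d * m
    deeper {m} 4i≤m = begin-strict
      s               <⟨ s<2^d*i ⟩
      2 * 2 ^ d * i   ≡⟨ cong (_* i) (*-comm 2 (2 ^ d)) ⟩
      2 ^ d * 2 * i   ≡⟨ *-assoc (2 ^ d) 2 i ⟩
      2 ^ d * (2 * i) ≤⟨ *-monoʳ-≤ (2 ^ d) (≤-trans (m≤n*m (2 * i) 2) 4i≤m) ⟩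
      2 ^ d * m       ∎

  -- Here `d` bounds the number of halvings; at `d = 0` only position 0 is left, where the root test
  -- stops the recursion.
  onMinLevel-time : ∀ fuel i d → i < 2 ^ d → time (onMinLevel fuel i) ≤ 3 * suc d
  onMinLevel-time zero       i       d       i<2^d = z≤n
  onMinLevel-time (suc fuel) zero    zero    i<2^d = s≤s z≤n
  onMinLevel-time (suc fuel) (suc i) zero    (s≤s ())
  onMinLevel-time (suc fuel) i       (suc d) i<2^d = begin
    time (onMinLevel (suc fuel) i)
      ≤⟨ s≤s (time-if (i ≤ᵇ 1) z≤n (λ _ →
         s≤s (+-monoˡ-≤ 1 (onMinLevel-time fuel ⌊ i /2⌋ d (⌊m/2⌋<n i<2^d))))) ⟩
    2 + (3 * suc d + 1)
      ≡⟨ cong (2 +_) (+-comm (3 * suc d) 1) ⟩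
    3 + 3 * suc d
      ≡⟨ *-suc 3 (suc d) ⟨
    3 * suc (suc d) ∎
    where open ≤-Reasoning

  -- A move climbs two levels, but lowering `d` once per move suffices for the bound.
  bubbleUp-time : ∀ _⊏_ fuel M i d → i < 2 ^ d →
                  time (bubbleUp _⊏_ fuel M i) ≤ 10 * suc d
  bubbleUp-time _⊏_ zero       M i       d       i<2^d = z≤n
  bubbleUp-time _⊏_ (suc fuel) M zero    zero    i<2^d = s≤s z≤n
  bubbleUp-time _⊏_ (suc fuel) M (suc i) zero    (s≤s ())
  bubbleUp-time _⊏_ (suc fuel) M i       (suc d) i<2^d = begin
    time (bubbleUp _⊏_ (suc fuel) M i)
      ≤⟨ s≤s (time-if (i <ᵇ 4) z≤n (λ _ →
         +-monoʳ-≤ 5 (time-if-not (M i ⊏ M ⌊ ⌊ i /2⌋ /2⌋) z≤n (λ _ →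
         +-monoʳ-≤ 4 (bubbleUp-time _⊏_ fuel _ _ d
           (≤-<-trans (⌊n/2⌋≤n ⌊ i /2⌋) (⌊m/2⌋<n i<2^d))))))) ⟩
    10 + 10 * suc d
      ≡⟨ *-suc 10 (suc d) ⟨
    10 * suc (suc d) ∎
    where open ≤-Reasoning

  placeUp-time : ∀ _⊏_ M i d → i < 2 ^ d → time (placeUp _⊏_ M i) ≤ 9 + 10 * suc d
  placeUp-time _⊏_ M i d i<2^d =
    s≤s (time-if (i ≤ᵇ 1) z≤n (λ _ →
    +-monoʳ-≤ 4 (time-if (M ⌊ i /2⌋ ⊏ M i)
      (+-monoʳ-≤ 4 (bubbleUp-time (flip _⊏_) ⌊ i /2⌋ _ ⌊ i /2⌋ d
        (≤-<-trans (⌊n/2⌋≤n i) i<2^d)))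
      (λ _ → m≤n⇒m≤o+n 4 (bubbleUp-time _⊏_ i M i d i<2^d)))))

  -- The upward walk starts at the new cell, whose position is `suc (size Q)`.
  insert-time : ∀ x Q d → suc (size Q) < 2 ^ d → time (insert x Q) ≤ 24 * suc d
  insert-time x (heap s M) d 1+s<2^d = begin
    time (insert x (heap s M))
      ≤⟨ +-monoʳ-≤ 2 (+-mono-≤ (onMinLevel-time (suc s) (suc s) d 1+s<2^d)
         (+-monoˡ-≤ 0 (time-if (result (onMinLevel (suc s) (suc s)))
           (placeUp-time _≺_ _ (suc s) d 1+s<2^d)
           (λ _ → placeUp-time (flip _≺_) _ (suc s) d 1+s<2^d)))) ⟩
    2 + (3 * suc d + (9 + 10 * suc d + 0))
      ≡⟨ cong (λ t → 2 + (3 * suc d + t)) (+-identityʳ (9 + 10 * suc d)) ⟩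
    2 + (3 * suc d + (9 + 10 * suc d))
      ≤⟨ +-monoʳ-≤ 2 (+-monoʳ-≤ (3 * suc d) (+-*-suc-≤ 9 10 d)) ⟩
    2 + (3 * suc d + 19 * suc d)
      ≡⟨ cong (2 +_) (*-distribʳ-+ (suc d) 3 19) ⟨
    2 + 22 * suc d
      ≤⟨ +-*-suc-≤ 2 22 d ⟩
    24 * suc d ∎
    where open ≤-Reasoning

  -- Since `i` is at least 1, `s < 2 ^ d` yields the `s < 2 ^ d * i` that `trickleDown-time` asks
  -- for.
  removeAt-time : ∀ _⊏_ i Q d .{{_ : NonZero i}} → size Q < 2 ^ d →
                  time (removeAt _⊏_ i Q) ≤ 45 * suc d
  removeAt-time _⊏_ i (heap s M) d s<2^d = begin
    time (removeAt _⊏_ i (heap s M))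
      ≤⟨ +-monoʳ-≤ 3 (+-monoˡ-≤ 0 (trickleDown-time _⊏_ (pred s) _ (pred s) i d
           (≤-<-trans pred[n]≤n (<-≤-trans s<2^d (m≤m*n (2 ^ d) i))))) ⟩
    3 + (42 * suc d + 0)
      ≡⟨ cong (3 +_) (+-identityʳ (42 * suc d)) ⟩
    3 + 42 * suc d
      ≤⟨ +-*-suc-≤ 3 42 d ⟩
    45 * suc d ∎
    where open ≤-Reasoning

  deleteMax-time : ∀ Q d → size Q < 2 ^ d → time (deleteMax Q) ≤ 51 * suc d
  deleteMax-time Q d s<2^d = ≤-trans
    (s≤s (time-if (size Q ≡ᵇ 0) z≤n (λ _ →
     s≤s (time-if (size Q ≡ᵇ 1) (m≤n⇒m≤o+n 4 (removeAt-time _ 1 Q d s<2^d)) (λ _ →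
     s≤s (time-if (size Q ≡ᵇ 2) (m≤n⇒m≤o+n 3 (removeAt-time _ 2 Q d s<2^d)) (λ _ →
     +-monoʳ-≤ 3 (secondOrThird (cells Q 2 ≺ cells Q 3)))))))))
    (+-*-suc-≤ 6 45 d)
    where
    -- Splitting on `b` turns the position into a numeral, which instance search recognises as
    -- nonzero.
    secondOrThird : ∀ b → time (removeAt (flip _≺_) (if b then 3 else 2) Q) ≤ 45 * suc d
    secondOrThird true  = removeAt-time _ 3 Q d s<2^d
    secondOrThird false = removeAt-time _ 2 Q d s<2^d

  deleteMax-size : ∀ Q → size (result (deleteMax Q)) ≤ size Q
  deleteMax-size (heap zero                M) = z≤n
  deleteMax-size (heap (suc zero)          M) = z≤n
  deleteMax-size (heap (suc (suc zero))    M) = s≤s z≤n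
  deleteMax-size (heap (suc (suc (suc s))) M) = n≤1+n _

  extractMin-time : ∀ Q d → size Q < 2 ^ d → time (extractMin Q) ≤ 47 * suc d
  extractMin-time Q d s<2^d = ≤-trans
    (s≤s (time-if (size Q ≡ᵇ 0) z≤n (λ _ →
     s≤s (≤-trans (≤-reflexive (+-identityʳ _)) (removeAt-time _≺_ 1 Q d s<2^d)))))
    (+-*-suc-≤ 2 45 d)

-- Running time of the iterations.

module AlgorithmTime {c ℓ₁ ℓ₂} (ℝ : OrderedField c ℓ₁ ℓ₂) where

  open OrderedField ℝ using (Carrier)
  open BestSubsets ℝ

  elements-time : ∀ {m} (B : Vec Bool m) R → time (elements B R) ≤ 2 * m
  elements-time         []      []      = z≤n
  elements-time {suc m} (b ∷ B) (r ∷ R) = begin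
    time (elements (b ∷ B) (r ∷ R))
      ≤⟨ +-mono-≤ (elements-time B R) (s≤s (time-if b ≤-refl (λ _ → z≤n))) ⟩
    2 * m + 2 ≡⟨ +-comm (2 * m) 2 ⟩
    2 + 2 * m ≡⟨ *-suc 2 m ⟨
    2 * suc m ∎
    where open ≤-Reasoning

  zeros-time : ∀ m → time (zeros m) ≤ m
  zeros-time zero    = z≤n
  zeros-time (suc m) = ≤-trans (+-monoˡ-≤ 1 (zeros-time m)) (≤-reflexive (+-comm m 1))

  module _ {n : ℕ} where

    open HeapTime (_≺_ {n})
    open H {n} using (heap; size; deleteMax; removeAt)

    -- `moveRight` takes 11 operations, so the longest paths take 2 + 2 + 11 + 1 here, 2 + 11 + 2 in
    -- `childB` and 4 + 5 in `childC`.
    childA-time : ∀ R (N : Node n) → time (childA R N) ≤ 16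
    childA-time R N =
      +-monoʳ-≤ 2 (time-if-not ((1 <ᵇ p₁ N) ∧ (p₁ N <ᵇ n)) z≤n (λ _ →
      +-monoʳ-≤ 2 (time-if (cell false (bits N) (suc (p₁ N))) z≤n (λ _ → ≤-refl))))

    childB-time : ∀ R (N : Node n) → time (childB R N) ≤ 15
    childB-time R N =
      +-monoʳ-≤ 2 (time-if-not ((0 <ᵇ p₂ N) ∧ (p₂ N <ᵇ n)) z≤n (λ _ → ≤-refl))

    childC-time : ∀ R (N : Node n) → time (childC R N) ≤ 9
    childC-time R N =
      +-monoʳ-≤ 4 (time-if-not ((p₁ N ≡ᵇ 2) ∧ (p₂ N ≡ᵇ 0) ∧ (p₃ N ≡ᵇ suc (ls N)))
        z≤n (λ _ → ≤-refl))

    insertMaybe-time : ∀ X Q d → suc (size Q) < 2 ^ d →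
                       time (insertMaybe X Q) ≤ 24 * suc d
    insertMaybe-time nothing  Q d 1+s<2^d = z≤n
    insertMaybe-time (just N) Q d 1+s<2^d = insert-time N Q d 1+s<2^d

    insertMaybe-size : ∀ X Q → size (result (insertMaybe X Q)) ≤ suc (size Q)
    insertMaybe-size nothing  Q = n≤1+n (size Q)
    insertMaybe-size (just N) Q = ≤-refl

    trim-size : ∀ b Q → size (result (if b then deleteMax Q else return Q)) ≤ size Q
    trim-size true  Q = deleteMax-size Q
    trim-size false Q = ≤-refl

    module _ {o} {O : Set o} (output : Node n → Timed O)
             {t} (output≤t : ∀ N → time (output N) ≤ t) (R : Vec Carrier n) (d : ℕ) where

      -- Every iteration extracts a node and inserts at most three, so
      -- size + 2 * (remaining iterations) never increases.
      iterate-time : ∀ k Q → size Q + 2 * k < 2 ^ d →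
                     time (iterate output R k Q) ≤ k * (t + 211 * suc d)
      iterate-time zero    Q             small = z≤n
      -- An empty heap ends the run after one test, which `211 * suc d` covers.
      iterate-time (suc k) (heap zero M) small =
        ≤-trans (s≤s z≤n) (≤-trans (*-monoʳ-≤ 211 (s≤s z≤n)) (≤-trans (m≤n+m _ t) (m≤m+n _ _)))
      iterate-time (suc k) Q@(heap (suc s) M) small =
        let N  = M 1
            Q₀ = result (removeAt _≺_ 1 Q)
            A  = result (childA R N)
            B  = result (childB R N)
            C  = result (childC R N)
            Q₁ = result (insertMaybe A Q₀)
            Q₂ = result (insertMaybe B Q₁)
            Q₃ = result (insertMaybe C Q₂)
            s₁ = insertMaybe-size A Q₀
            s₂ = ≤-trans (insertMaybe-size B Q₁) (s≤s s₁)
            s₃ = ≤-trans (insertMaybe-size C Q₂) (s≤s s₂)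
            tooMany = k <ᵇ size Q₃
            Q₄ = result (if tooMany then deleteMax Q₃ else return Q₃)
            s₄ = ≤-trans (trim-size tooMany Q₃) s₃
        in begin
        _
          ≤⟨ +-mono-≤ (extractMin-time Q d (bounded (m≤n+m (suc s) 2))) (
             +-mono-≤ (output≤t N) (
             +-mono-≤ (childA-time R N) (
             +-mono-≤ (childB-time R N) (
             +-mono-≤ (childC-time R N) (
             +-mono-≤ (insertMaybe-time A Q₀ d (bounded (m≤n+m (suc s) 2))) (
             +-mono-≤ (insertMaybe-time B Q₁ d (bounded (s≤s (m≤n⇒m≤1+n s₁)))) (
             +-mono-≤ (insertMaybe-time C Q₂ d (bounded (s≤s s₂))) (
             s≤s (
             +-mono-≤ (time-if tooMany (deleteMax-time Q₃ d (bounded s₃)) (λ _ → z≤n)) (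
             +-monoˡ-≤ 0 (iterate-time k Q₄ (≤-<-trans (+-monoˡ-≤ (2 * k) s₄) small′)))))))))))) ⟩
        -- 41 = 16 + 15 + 9 + 1 for the three children and the test `tooMany`; 170 = 47 + 3 * 24 +
        -- 51 for the heap operations.
        _ ≡⟨ collect t (suc d) (k * (t + 211 * suc d)) ⟩
        (t + (41 + 170 * suc d)) + k * (t + 211 * suc d)
          ≤⟨ +-monoˡ-≤ (k * (t + 211 * suc d)) (+-monoʳ-≤ t (+-*-suc-≤ 41 170 d)) ⟩
        suc k * (t + 211 * suc d) ∎
        where
        open ≤-Reasoning
        small′ : 3 + s + 2 * k < 2 ^ d
        small′ = subst (_< 2 ^ d) (shift s k) small
          where
          shift : ∀ s k → suc s + 2 * suc k ≡ 3 + s + 2 * k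
          shift = solve 2 (λ s k → (con 1 :+ s) :+ con 2 :* (con 1 :+ k) :=
                                   con 3 :+ s :+ con 2 :* k) refl
        -- Serves every intermediate heap of the iteration: the three insertions leave at most
        -- `3 + s` elements.
        bounded : ∀ {m} → m ≤ 3 + s → m < 2 ^ d
        bounded m≤3+s = ≤-<-trans (≤-trans m≤3+s (m≤m+n (3 + s) (2 * k))) small′
        collect : ∀ t e r →
          47 * e + (t + (16 + (15 + (9 + (24 * e + (24 * e + (24 * e +
            suc (51 * e + (r + 0))))))))) ≡
          (t + (41 + 170 * e)) + r
        collect = solve 3 (λ t e r →
          con 47 :* e :+ (t :+ (con 16 :+ (con 15 :+ (con 9 :+ (con 24 :* e :+ (con 24 :* e :+ (con 24 :* e :+
            (con 1 :+ (con 51 :* e :+ (r :+ con 0))))))))))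
          := (t :+ (con 41 :+ con 170 :* e)) :+ r) refl

      -- Beyond `n`, creating and inserting the root costs at most `30 * suc d`. As `k` is at least
      -- 1, this may be charged to each iteration: 241 = 211 + 30.
      afterSorting-time : ∀ k .{{_ : NonZero k}} → 1 + 2 * k < 2 ^ d →
                          time (afterSorting output R k) ≤ n + k * (t + 241 * suc d)
      afterSorting-time k small = begin
        time (afterSorting output R k)
          ≤⟨ +-mono-≤ (+-monoˡ-≤ 6 (zeros-time n))
               (+-mono-≤ (insert-time N (H.empty N) d
                           (≤-<-trans (≤-trans (>-nonZero⁻¹ k) (≤-trans (m≤n*m k 2) (n≤1+n _))) small))
                         (iterate-time k _ small)) ⟩
        (n + 6) + (24 * suc d + k * (t + 211 * suc d))
          ≡⟨ collect n (24 * suc d) (k * (t + 211 * suc d)) ⟩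
        n + ((6 + 24 * suc d) + k * (t + 211 * suc d))
          ≤⟨ +-monoʳ-≤ n (+-monoˡ-≤ _ (≤-trans (+-*-suc-≤ 6 24 d) (m≤n*m (30 * suc d) k))) ⟩
        n + (k * (30 * suc d) + k * (t + 211 * suc d))
          ≡⟨ merge n k t (suc d) ⟩
        n + k * (t + 241 * suc d) ∎
        where
        open ≤-Reasoning
        N = result (root R)
        collect : ∀ n a b → (n + 6) + (a + b) ≡ n + ((6 + a) + b)
        collect = solve 3 (λ n a b → (n :+ con 6) :+ (a :+ b) := n :+ ((con 6 :+ a) :+ b)) refl
        merge : ∀ n k t e → n + (k * (30 * e) + k * (t + 211 * e)) ≡ n + k * (t + 241 * e)
        merge = solve 4 (λ n k t e → n :+ (k :* (con 30 :* e) :+ k :* (t :+ con 211 :* e)) :=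
                                     n :+ k :* (t :+ con 241 :* e)) refl

-- The bounds in terms of the logarithm of `k`.

-- The term 3 k is absorbed by k log₂ k if 2 ≤ k, and by N if k = 1.
k*[3+log₂k]≤4*[N+k*log₂k] : ∀ N k .{{_ : NonZero N}} .{{_ : NonZero k}} →
                            k * (3 + ⌊log₂ k ⌋) ≤ 4 * (N + k * ⌊log₂ k ⌋)
k*[3+log₂k]≤4*[N+k*log₂k] N 1             =
  ≤-trans (n≤1+n 3) (*-monoʳ-≤ 4 (≤-trans (>-nonZero⁻¹ N) (m≤m+n N 0)))
k*[3+log₂k]≤4*[N+k*log₂k] N k@(suc (suc _)) = begin
  k * (3 + L)     ≤⟨ *-monoʳ-≤ k (+-monoˡ-≤ L (*-monoʳ-≤ 3 1≤L)) ⟩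
  k * (3 * L + L) ≡⟨ solve 2 (λ k L → k :* (con 3 :* L :+ L) := con 4 :* (k :* L)) refl k L ⟩
  4 * (k * L)     ≤⟨ *-monoʳ-≤ 4 (m≤n+m (k * L) N) ⟩
  4 * (N + k * L) ∎
  where
  open ≤-Reasoning
  L = ⌊log₂ k ⌋
  1≤L : 1 ≤ L
  1≤L = ⌊log₂⌋-mono-≤ {2} {k} (s≤s (s≤s z≤n))

-- Fixes the `d` of `afterSorting-time`, so that `suc d` becomes `3 + ⌊log₂ k ⌋`.
1+2k<2^[2+⌊log₂k⌋] : ∀ k → 1 + 2 * k < 2 ^ (2 + ⌊log₂ k ⌋)
1+2k<2^[2+⌊log₂k⌋] k = begin
  2 + 2 * k              ≡⟨ *-suc 2 k ⟨
  2 * suc k              ≤⟨ *-monoʳ-≤ 2 (n<2^[1+⌊log₂n⌋] k) ⟩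
  2 ^ (2 + ⌊log₂ k ⌋)    ∎
  where open ≤-Reasoning

lemma3p11 :
    ∀ {c ℓ₁ ℓ₂} (ℝ : OrderedField c ℓ₁ ℓ₂) →
    let open OrderedField ℝ using (Carrier)
        open BestSubsets ℝ
    in
    -- The bounds with ⌊log₂ k⌋ imply those with the real number log₂ k.
    (∃[ C ] ∀ n .{{_ : NonZero n}} (R : Vec Carrier n) → Unique R →
       ∀ k .{{_ : NonZero k}} →
       time (algorithm2 R k) ≤ C * (n + k * ⌊log₂ k ⌋))
    ×
    (∃[ C ] ∀ n .{{_ : NonZero n}} (R : Vec Carrier n) → Unique R →
       ∀ k .{{_ : NonZero k}} →
       time (algorithm2Reporting R k) ≤ C * (n * k + k * ⌊log₂ k ⌋))
lemma3p11 ℝ = (969 , λ n R _ k → emitting n R k) , (971 , λ n R _ k → reporting n R k)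
  where
  open OrderedField ℝ using (Carrier)
  open BestSubsets ℝ
  open AlgorithmTime ℝ
  open ≤-Reasoning

  -- With the output step, 241 becomes 242 per iteration; then 969 = 1 + 4 * 242.
  emitting : ∀ n .{{_ : NonZero n}} (R : Vec Carrier n) k .{{_ : NonZero k}} →
             time (algorithm2 R k) ≤ 969 * (n + k * ⌊log₂ k ⌋)
  emitting n R k = begin
    time (algorithm2 R k)
      ≤⟨ afterSorting-time emit (λ _ → ≤-refl) (sort R) (2 + L) k (1+2k<2^[2+⌊log₂k⌋] k) ⟩
    n + k * (1 + 241 * (3 + L))
      ≤⟨ +-monoʳ-≤ n (*-monoʳ-≤ k (+-*-suc-≤ 1 241 (2 + L))) ⟩
    n + k * (242 * (3 + L))
      ≡⟨ solve 3 (λ n k e → n :+ k :* (con 242 :* e) := n :+ con 242 :* (k :* e)) refl n k (3 + L) ⟩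
    n + 242 * (k * (3 + L))
      ≤⟨ +-mono-≤ (m≤m+n n (k * L)) (*-monoʳ-≤ 242 (k*[3+log₂k]≤4*[N+k*log₂k] n k)) ⟩
    (n + k * L) + 242 * (4 * (n + k * L))
      ≡⟨ solve 1 (λ x → x :+ con 242 :* (con 4 :* x) := con 969 :* x) refl (n + k * L) ⟩
    969 * (n + k * L) ∎
    where L = ⌊log₂ k ⌋

  -- Three copies of `n * k` arise: one bounds the initial `n`, two pay for `elements`. Hence 971 =
  -- 3 + 4 * 242.
  reporting : ∀ n .{{_ : NonZero n}} (R : Vec Carrier n) k .{{_ : NonZero k}} →
              time (algorithm2Reporting R k) ≤ 971 * (n * k + k * ⌊log₂ k ⌋)
  reporting n R k = begin
    time (algorithm2Reporting R k)
      ≤⟨ afterSorting-time (report (sort R)) (λ N → +-monoˡ-≤ 1 (elements-time (bits N) (sort R)))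
           (sort R) (2 + L) k (1+2k<2^[2+⌊log₂k⌋] k) ⟩
    n + k * (2 * n + 1 + 241 * (3 + L))
      ≡⟨ cong (λ t → n + k * t) (+-assoc (2 * n) 1 (241 * (3 + L))) ⟩
    n + k * (2 * n + (1 + 241 * (3 + L)))
      ≤⟨ +-mono-≤ (m≤m*n n k)
           (*-monoʳ-≤ k (+-monoʳ-≤ (2 * n) (+-*-suc-≤ 1 241 (2 + L)))) ⟩
    n * k + k * (2 * n + 242 * (3 + L))
      ≡⟨ solve 3 (λ n k e → n :* k :+ k :* (con 2 :* n :+ con 242 :* e) :=
                            con 3 :* (n :* k) :+ con 242 :* (k :* e)) refl n k (3 + L) ⟩
    3 * (n * k) + 242 * (k * (3 + L))
      -- The term 3 k is absorbed with `n * k` in the role of `N`.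
      ≤⟨ +-mono-≤ (*-monoʳ-≤ 3 (m≤m+n (n * k) (k * L)))
           (*-monoʳ-≤ 242 (k*[3+log₂k]≤4*[N+k*log₂k] (n * k) k {{m*n≢0 n k}})) ⟩
    3 * (n * k + k * L) + 242 * (4 * (n * k + k * L))
      ≡⟨ solve 1 (λ x → con 3 :* x :+ con 242 :* (con 4 :* x) := con 971 :* x) refl (n * k + k * L) ⟩
    971 * (n * k + k * L) ∎
    where L = ⌊log₂ k ⌋
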